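{- Let $n$ be a positive integer. The set $A_n=\{G_\alpha:\alpha\in\{0,1\}^n\text{ breaks the ballot condition}\}$ is a (non-reduced, non-minimal) Gröbner basis of $I_n$. A minimal Gröbner basis for $I_n$ is given by $$\big\{G_\alpha:\alpha\in\{0,1\}^n\text{ breaks the ballot condition only at the rightmost }1\text{ of }\alpha\big\}.$$
   Context: Let $R_n=\mathbb{Q}[\theta_1,\dots,\theta_n]$ be the polynomial ring in anticommuting variables over $\mathbb{Q}$ (exterior algebra): $\theta_i\theta_j=-\theta_j\theta_i$ for $i\ne j$, $\theta_i^2=0$. For $A=\{a_1<\cdots<a_r\}\subseteq[n]=\{1,\dots,n\}$ put $\theta_A=\theta_{a_1}\cdots\theta_{a_r}$, and $F_{1^r}=\sum_{A\subseteq[n],|A|=r}\theta_A$ (so $F_{1^0}=1$). Let $I_n$ be the ideal of $R_n$ generated by $F_{1^r}$, $1\le r\le n$. A sequence $\alpha=(a_1,\dots,a_n)\in\{0,1\}^n$ breaks the ballot condition at position $r$ if $\sum_{i=1}^r a_i>r/2$; it breaks the ballot condition if it does so at some position $1\le r\le n$, and otherwise it is a ballot sequence. It breaks the ballot condition only at its rightmost $1$ if the position of the rightmost $1$ of $\alpha$ is the only position at which it breaks the ballot condition. For a $0$-$1$ string $u$ let $m_1(u)$ be its number of $1$s. For $\alpha\in\{0,1\}^n$ (written as a string) the element $G_\alpha\in R_n$ is defined recursively: $G_{1^s0^{n-s}}=F_{1^s}$ for $0\le s\le n$; otherwise $\alpha$ is uniquely of the form $u01^s0^{n-k-s}$ with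 $s\ge 1$ and $u$ a string of length $k-1$, and $$G_{u01^s0^{n-k-s}}=G_{u1^s0^{n-k-s+1}}-(-1)^{m_1(u)}\theta_k\,G_{u1^{s-1}0^{n-k-s+2}}.$$ Gröbner bases are taken with respect to the lexicographic order: monomials $\theta^\alpha=\theta_1^{a_1}\cdots\theta_n^{a_n}$, $\alpha\in\{0,1\}^n$, are ordered by $\theta^\alpha<\theta^\beta$ iff there is $j$ with $a_i=b_i$ for $i<j$ and $a_j<b_j$ (so $\theta_1>\cdots>\theta_n$). The leading monomial of a nonzero polynomial is its lexicographically largest monomial. A Gröbner basis of $I_n$ is a finite set $\mathcal{G}\subseteq I_n$ of nonzero elements such that the leading monomial of each nonzero $f\in I_n$ is divisible by the leading monomial of some $g\in\mathcal{G}$ ($\theta_B$ divides $\theta_A$ iff $B\subseteq A$). It is minimal if all leading coefficients are $1$ and no leading monomial of an element of $\mathcal{G}$ divides the leading monomial of a different element of $\mathcal{G}$; it is reduced if all leading coefficients are $1$ and no monomial occurring in an element of $\mathcal{G}$ is divisible by the leading monomial of a different element of $\mathcal{G}$.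
   Formalization: The parenthetical "non-reduced, non-minimal" is claimed only for n ≥ 2, since for n = 1 the set A_1 = {θ_1} is both minimal and reduced; all other claims are for every positive n. -}

module Defs where

open import Level using (0ℓ)
open import Data.Bool.Base as Bool using (Bool; true; false; if_then_else_)
open import Data.Nat.Base as ℕ using (ℕ; zero; suc)
import Data.Nat.Properties as ℕ
open import Data.Fin.Base as Fin using (Fin; zero; suc; toℕ; fromℕ<)
open import Data.Fin.Subset using (Subset; inside; outside; ⁅_⁆; _⊆_; _─_; ∣_∣)
open import Data.Fin.Subset.Properties using (_⊆?_)
open import Data.Rational.Base as ℚ using (ℚ; 0ℚ; 1ℚ)
open import Data.List.Base as List using (List)
open import Data.List.Relation.Unary.Any using (Any)
open import Data.Vec.Base using (Vec; []; _∷_; lookup; reverse)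
open import Data.Vec.Properties using (≡-dec)
open import Data.Vec.Relation.Binary.Lex.Strict using (Lex-≤)
open import Data.Product.Base using (∃-syntax; _×_)
import Data.Bool.Properties as Bool
open import Function.Bundles using (_⇔_)
open import Relation.Binary.PropositionalEquality.Core using (_≡_; _≢_; _≗_)
open import Relation.Nullary using (¬_; does)
open import Relation.Unary using (Pred)

------------------------------------------------------------------------
-- The exterior algebra R n over ℚ on θ₁, …, θₙ

-- f : R n stands for Σ_A (f A) θ_A.  Since R n is a function type, equality
-- of elements is pointwise equality _≗_ of coefficients, never _≡_.
-- The index i : Fin n stands for the position toℕ i + 1 of the mathematics,
-- and a 0-1 sequence is identified with its support: inside = true = 1.
R : ℕ → Set
R n = Subset n → ℚ

subsets : ∀ n → List (Subset n)
subsets zero    = [] List.∷ List.[]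
subsets (suc n) = List.map (outside ∷_) (subsets n)
           List.++ List.map (inside  ∷_) (subsets n)

sign : ℕ → ℚ
sign zero    = 1ℚ
sign (suc k) = ℚ.- sign k

-- The number of pairs (a , b) with a ∈ A, b ∈ B and a > b.
inversions : ∀ {n} → Subset n → Subset n → ℕ
inversions []      []            = 0
inversions (_ ∷ A) (inside  ∷ B) = ∣ A ∣ ℕ.+ inversions A B
inversions (_ ∷ A) (outside ∷ B) = inversions A B

infixl 6 _+_ _-_
infixl 7 _*_

0ᴿ : ∀ {n} → R n
0ᴿ _ = 0ℚ

_+_ _-_ _*_ : ∀ {n} → R n → R n → R n
(f + g) A = f A ℚ.+ g A
(f - g) A = f A ℚ.- g A

-- θ_A θ_B is 0 if A and B meet, and (-1)^(inversions A B) θ_(A ∪ B) if they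
-- are disjoint; so the coefficient at θ_C collects the pairs (A , C ─ A)
-- with A ⊆ C.
_*_ {n} f g C = List.foldr ℚ._+_ 0ℚ (List.map term (List.filter (_⊆? C) (subsets n)))
  where
  term : Subset n → ℚ
  term A = sign (inversions A (C ─ A)) ℚ.* (f A ℚ.* g (C ─ A))

infixr 8 _•_

_•_ : ∀ {n} → ℚ → R n → R n
(c • f) A = c ℚ.* f A

monomial : ∀ {n} → Subset n → R n
monomial A B = if does (≡-dec Bool._≟_ A B) then 1ℚ else 0ℚ

θ : ∀ {n} → Fin n → R n
θ i = monomial ⁅ i ⁆

-- F r = F_{1^r}, the sum of all θ_A with ∣A∣ = r.
F : ∀ {n} → ℕ → R n
F r A = if does (∣ A ∣ ℕ.≟ r) then 1ℚ else 0ℚ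

------------------------------------------------------------------------
-- Ideals

data ⟨_⟩ {n} (S : Pred (R n) 0ℓ) : Pred (R n) 0ℓ where
  generator : ∀ {f} → S f → ⟨ S ⟩ f
  zeroᴵ     : ⟨ S ⟩ 0ᴿ
  plus      : ∀ {f g} → ⟨ S ⟩ f → ⟨ S ⟩ g → ⟨ S ⟩ (f + g)
  timesˡ    : ∀ h {f} → ⟨ S ⟩ f → ⟨ S ⟩ (h * f)
  timesʳ    : ∀ h {f} → ⟨ S ⟩ f → ⟨ S ⟩ (f * h)
  respects  : ∀ {f g} → f ≗ g → ⟨ S ⟩ f → ⟨ S ⟩ g

I : ∀ n → Pred (R n) 0ℓ
I n = ⟨ (λ f → ∃[ r ] (1 ℕ.≤ r × r ℕ.≤ n × f ≗ F r)) ⟩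

------------------------------------------------------------------------
-- Ballot sequences

bit : Bool → ℕ
bit b = if b then 1 else 0

-- partialSum α i = a₁ + ⋯ + a_r for the position r = toℕ i + 1.
partialSum : ∀ {n} → Vec Bool n → Fin n → ℕ
partialSum (a ∷ α) zero    = bit a
partialSum (a ∷ α) (suc i) = bit a ℕ.+ partialSum α i

-- The condition a₁ + ⋯ + a_r > r / 2, cleared of its denominator.
BreaksAt : ∀ {n} → Vec Bool n → Fin n → Set
BreaksAt α i = suc (toℕ i) ℕ.< 2 ℕ.* partialSum α i

BreaksBallot : ∀ {n} → Vec Bool n → Set
BreaksBallot α = ∃[ i ] BreaksAt α i

IsRightmostOne : ∀ {n} → Vec Bool n → Fin n → Set
IsRightmostOne α i = lookup α i ≡ true × (∀ j → i Fin.< j → lookup α j ≡ false)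

BreaksBallotOnlyAtRightmostOne : ∀ {n} → Vec Bool n → Set
BreaksBallotOnlyAtRightmostOne α =
  ∃[ i ] (IsRightmostOne α i × (∀ j → BreaksAt α j ⇔ j ≡ i))

------------------------------------------------------------------------
-- The elements G_α

-- Let u be a 0-1 string of length k ≤ n.  Then, with ū its reversal,
-- Gᵣ k≤n ū s = G_α for α = u 1^s 0^(n-k-s).  Reading u from its right end:
--   * u empty gives the base case G_{1^s 0^(n-s)} = F_{1^s};
--   * a last letter 1 joins the block 1^s;
--   * a last letter 0 with s = 0 joins the final block of zeros;
--   * a last letter 0 with s ≥ 1 is the recursive rule, in which
--     1^s 0^(n-k-s+1) and 1^(s-1) 0^(n-k-s+2) follow the rest of u and the
--     variable is the one at the position of that letter 0.
Gᵣ : ∀ {n k} → k ℕ.≤ n → Vec Bool k → ℕ → R n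
Gᵣ _   []          s       = F s
Gᵣ k≤n (true  ∷ u) s       = Gᵣ (ℕ.<⇒≤ k≤n) u (suc s)
Gᵣ k≤n (false ∷ u) zero    = Gᵣ (ℕ.<⇒≤ k≤n) u zero
Gᵣ k≤n (false ∷ u) (suc s) =
  Gᵣ (ℕ.<⇒≤ k≤n) u (suc s) - sign ∣ u ∣ • (θ (fromℕ< k≤n) * Gᵣ (ℕ.<⇒≤ k≤n) u s)

G : ∀ {n} → Vec Bool n → R n
G α = Gᵣ ℕ.≤-refl (reverse α) 0

------------------------------------------------------------------------
-- Gröbner bases

-- Lexicographic order on exponent vectors, with false < true.
infix 4 _≤ˡᵉˣ_
_≤ˡᵉˣ_ : ∀ {n} → Subset n → Subset n → Set
_≤ˡᵉˣ_ = Lex-≤ _≡_ Bool._<_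

-- Occurs f A: the monomial θ_A occurs in f.
Occurs : ∀ {n} → R n → Subset n → Set
Occurs f A = f A ≢ 0ℚ

-- LeadingMonomial f A: θ_A is the leading monomial of f (so f is nonzero and
-- the leading coefficient of f is f A).
LeadingMonomial : ∀ {n} → R n → Subset n → Set
LeadingMonomial f A = Occurs f A × (∀ B → Occurs f B → B ≤ˡᵉˣ A)

-- Sets of polynomials are predicates; distinctness and finiteness of their
-- elements are up to _≗_.
IsFinite : ∀ {n} → Pred (R n) 0ℓ → Set
IsFinite {n} 𝒢 = ∃[ gs ] (∀ (g : R n) → 𝒢 g ⇔ Any (g ≗_) gs)

record IsGröbnerBasis {n} (J 𝒢 : Pred (R n) 0ℓ) : Set where
  field
    finite   : IsFinite 𝒢
    ⊆-ideal  : ∀ g → 𝒢 g → J g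
    nonzero  : ∀ g → 𝒢 g → ¬ (g ≗ 0ᴿ)
    divides  : ∀ f A → J f → LeadingMonomial f A →
               ∃[ g ] ∃[ B ] (𝒢 g × LeadingMonomial g B × B ⊆ A)

LeadingCoefficientsOne : ∀ {n} → Pred (R n) 0ℓ → Set
LeadingCoefficientsOne 𝒢 = ∀ g A → 𝒢 g → LeadingMonomial g A → g A ≡ 1ℚ

record IsMinimal {n} (𝒢 : Pred (R n) 0ℓ) : Set where
  field
    monic      : LeadingCoefficientsOne 𝒢
    no-divisor : ∀ g h A B → 𝒢 g → 𝒢 h → ¬ (g ≗ h) →
                 LeadingMonomial g A → LeadingMonomial h B → ¬ (A ⊆ B)

record IsReduced {n} (𝒢 : Pred (R n) 0ℓ) : Set where
  field
    monic      : LeadingCoefficientsOne 𝒢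
    no-divisor : ∀ g h A B → 𝒢 g → 𝒢 h → ¬ (g ≗ h) →
                 LeadingMonomial g A → Occurs h B → ¬ (A ⊆ B)

------------------------------------------------------------------------
-- The two sets of polynomials

𝒜 : ∀ n → Pred (R n) 0ℓ
𝒜 n g = ∃[ α ] (BreaksBallot {n} α × g ≗ G α)

ℳ : ∀ n → Pred (R n) 0ℓ
ℳ n g = ∃[ α ] (BreaksBallotOnlyAtRightmostOne {n} α × g ≗ G α)

{-# OPTIONS --safe #-}
module Submission where

-- The coefficient of θ₁^b in G_{bβ} is G_β in the remaining variables, with
-- no θ₁ at all if b = 0, so G_α has leading term θ^α; the recursion for G_α
-- never leaves the sequences that break the ballot condition, so these have
-- G_α ∈ I.
--
-- Conversely, no ballot sequence is the exponent of the leading monomial of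
-- an f ∈ I.  Contracting by θ_{i+1} - θ_i and then setting θ_i = θ_{i+1} = 0
-- is a skew derivation that kills every F_r, hence maps the ideal in n + 2
-- variables to the one in n variables.  If f has no monomial above θ^{u01v},
-- with 01 at the positions i, i+1, then its image has no monomial above
-- θ^{uv}, and the coefficients there agree up to sign.  Removing adjacent
-- pairs 01 turns a ballot sequence into 0^m, and elements of I have no
-- constant term.
--
-- Every sequence that breaks the ballot condition contains one that breaks it
-- only at its rightmost 1 (stop at the first break and continue with zeros),
-- and these form an antichain.

open import Defs
open import Data.Bool.Base as Bool using (Bool; true; false; if_then_else_; not)
import Data.Bool.Properties as Bool
open import Data.Empty using (⊥-elim)
open import Data.Fin.Base as Fin using (Fin; zero; suc; toℕ; fromℕ<)
import Data.Fin.Properties as Fin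
open import Data.Fin.Subset using (Subset; inside; outside; _⊆_; _─_; ∣_∣; ⊥)
open import Data.Fin.Subset.Properties
  using (_⊆?_; ∣p∣≤n; ∣⊥∣≡0; ⊆-refl; out⊆; in⊆in; drop-∷-⊆; ⊥⊆)
open import Data.List.Base as List using (List)
open import Data.List.Membership.Propositional using (_∈_; find; lose)
open import Data.List.Membership.Propositional.Properties
  using (∈-filter⁺; ∈-filter⁻; ∈-map⁺; ∈-++⁺ˡ; ∈-++⁺ʳ)
import Data.List.Properties as List
import Data.List.Relation.Unary.Any as Any
import Data.List.Relation.Unary.Any.Properties as Any
open import Data.Nat.Base as ℕ using (ℕ; zero; suc; _≤_; z≤n; s≤s)
import Data.Nat.Properties as ℕ
open import Data.Product.Base using (_×_; _,_; ∃-syntax)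
open import Data.Rational.Base as ℚ using (ℚ; 0ℚ; 1ℚ)
import Data.Rational.Properties as ℚ
open import Data.Rational.Solver using (module +-*-Solver)
open import Data.Sum.Base using (_⊎_; inj₁; inj₂)
open import Data.Unit.Base using (tt)
open import Data.Vec.Base using ([]; _∷_; _∷ʳ_; reverse; here; lookup)
open import Data.Vec.Properties using (reverse-∷; lookup-replicate; ≡-dec)
open import Data.Vec.Relation.Binary.Lex.Strict using (base; this; next; ≤-antisym)
open import Data.Vec.Relation.Binary.Pointwise.Inductive using (Pointwise-≡⇒≡)
open import Function.Base using (_∘_; id)
open import Function.Bundles using (_⇔_; mk⇔; Equivalence)
open import Level using (0ℓ)
open import Relation.Binary.PropositionalEquality
open import Relation.Nullary using (¬_; Dec; does; yes; no; contradiction)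
open import Relation.Nullary.Decidable using (dec-false; map′)
open import Relation.Unary using (Pred; Decidable)

open +-*-Solver using (solve; _:=_; _:+_; _:*_; :-_; _:-_; con)

private
  variable
    n k : ℕ

-- The product, one variable at a time

part : Bool → R (suc n) → R n
part b f A = f (b ∷ A)

infix 8 _̂
-- The parity involution: θ_A is multiplied by (-1)^∣A∣, the sign for moving one variable past θ_A.
_̂ : R n → R n
(f ̂) A = sign ∣ A ∣ ℚ.* f A

-ᴿ_ : R n → R n
(-ᴿ f) A = ℚ.- f A

sign-+ : ∀ a b → sign (a ℕ.+ b) ≡ sign a ℚ.* sign b
sign-+ zero    b = sym (ℚ.*-identityˡ (sign b))
sign-+ (suc a) b = trans (cong ℚ.-_ (sign-+ a b)) (ℚ.neg-distribˡ-* (sign a) (sign b))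

-- The product, computed by splitting off the first variable: with
-- f = f₀ + θ₁f₁, moving θ₁ to the front past f₀ applies the parity involution.
infixl 7 _⊛_
_⊛_ : R n → R n → R n
(f ⊛ g) []            = f [] ℚ.* g []
(f ⊛ g) (outside ∷ C) = (part outside f ⊛ part outside g) C
(f ⊛ g) (inside  ∷ C) =
  (part outside f ̂ ⊛ part inside g) C ℚ.+ (part inside f ⊛ part outside g) C

-- Sums over the subsets of a set

sumBy : {A : Set} → (A → ℚ) → List A → ℚ
sumBy h = List.foldr ℚ._+_ 0ℚ ∘ List.map h

sumBy-cong : ∀ {A : Set} {h h′ : A → ℚ} → h ≗ h′ → sumBy h ≗ sumBy h′
sumBy-cong eq = cong (List.foldr ℚ._+_ 0ℚ) ∘ List.map-cong eq

sumBy-map : ∀ {A B : Set} (h : B → ℚ) (k : A → B) xs →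
            sumBy h (List.map k xs) ≡ sumBy (h ∘ k) xs
sumBy-map h k xs = cong (List.foldr ℚ._+_ 0ℚ) (sym (List.map-∘ xs))

sumBy-++ : ∀ {A : Set} (h : A → ℚ) xs ys →
           sumBy h (xs List.++ ys) ≡ sumBy h xs ℚ.+ sumBy h ys
sumBy-++ h List.[]       ys = sym (ℚ.+-identityˡ _)
sumBy-++ h (x List.∷ xs) ys =
  trans (cong (h x ℚ.+_) (sumBy-++ h xs ys)) (sym (ℚ.+-assoc (h x) (sumBy h xs) (sumBy h ys)))

filter-out : ∀ b (C : Subset n) As →
  List.filter (_⊆? (b ∷ C)) (List.map (outside ∷_) As) ≡ List.map (outside ∷_) (List.filter (_⊆? C) As)
filter-out b C List.[] = refl
-- The decision on the longer sets computes from the boolean for `A` and `C`; abstracting that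
-- boolean lets both filters reduce.
filter-out b C (A List.∷ As) with does (A ⊆? C)
... | true  = cong ((outside ∷ A) List.∷_) (filter-out b C As)
... | false = filter-out b C As

filter-in-in : ∀ (C : Subset n) As →
  List.filter (_⊆? (inside ∷ C)) (List.map (inside ∷_) As) ≡ List.map (inside ∷_) (List.filter (_⊆? C) As)
filter-in-in C List.[] = refl
filter-in-in C (A List.∷ As) with does (A ⊆? C)
... | true  = cong ((inside ∷ A) List.∷_) (filter-in-in C As)
... | false = filter-in-in C As

filter-in-out : ∀ (C : Subset n) As →
  List.filter (_⊆? (outside ∷ C)) (List.map (inside ∷_) As) ≡ List.[]
filter-in-out C List.[]       = refl
filter-in-out C (A List.∷ As) = filter-in-out C As

subsetsOf : Subset n → List (Subset n)
subsetsOf C = List.filter (_⊆? C) (subsets _)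

sumBy-subsets-out : ∀ (h : Subset (suc n) → ℚ) C →
  sumBy h (subsetsOf (outside ∷ C)) ≡ sumBy (h ∘ (outside ∷_)) (subsetsOf C)
sumBy-subsets-out {n} h C = begin
  sumBy h (List.filter (_⊆? (outside ∷ C)) (outs List.++ ins))
    ≡⟨ cong (sumBy h) (List.filter-++ (_⊆? (outside ∷ C)) outs ins) ⟩
  sumBy h (List.filter (_⊆? (outside ∷ C)) outs List.++ List.filter (_⊆? (outside ∷ C)) ins)
    ≡⟨ cong (sumBy h) (cong₂ List._++_ (filter-out outside C (subsets n)) (filter-in-out C (subsets n))) ⟩
  sumBy h (List.map (outside ∷_) (subsetsOf C) List.++ List.[])
    ≡⟨ cong (sumBy h) (List.++-identityʳ (List.map (outside ∷_) (subsetsOf C))) ⟩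
  sumBy h (List.map (outside ∷_) (subsetsOf C))
    ≡⟨ sumBy-map h (outside ∷_) (subsetsOf C) ⟩
  sumBy (h ∘ (outside ∷_)) (subsetsOf C) ∎
  where
  open ≡-Reasoning
  outs = List.map (outside ∷_) (subsets n)
  ins  = List.map (inside ∷_) (subsets n)

sumBy-subsets-in : ∀ (h : Subset (suc n) → ℚ) C →
  sumBy h (subsetsOf (inside ∷ C)) ≡
  sumBy (h ∘ (outside ∷_)) (subsetsOf C) ℚ.+ sumBy (h ∘ (inside ∷_)) (subsetsOf C)
sumBy-subsets-in {n} h C = begin
  sumBy h (List.filter (_⊆? (inside ∷ C)) (outs List.++ ins))
    ≡⟨ cong (sumBy h) (List.filter-++ (_⊆? (inside ∷ C)) outs ins) ⟩
  sumBy h (List.filter (_⊆? (inside ∷ C)) outs List.++ List.filter (_⊆? (inside ∷ C)) ins)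
    ≡⟨ cong (sumBy h) (cong₂ List._++_ (filter-out inside C (subsets n)) (filter-in-in C (subsets n))) ⟩
  sumBy h (List.map (outside ∷_) (subsetsOf C) List.++ List.map (inside ∷_) (subsetsOf C))
    ≡⟨ sumBy-++ h (List.map (outside ∷_) (subsetsOf C)) _ ⟩
  sumBy h (List.map (outside ∷_) (subsetsOf C)) ℚ.+ sumBy h (List.map (inside ∷_) (subsetsOf C))
    ≡⟨ cong₂ ℚ._+_ (sumBy-map h (outside ∷_) (subsetsOf C)) (sumBy-map h (inside ∷_) (subsetsOf C)) ⟩
  sumBy (h ∘ (outside ∷_)) (subsetsOf C) ℚ.+ sumBy (h ∘ (inside ∷_)) (subsetsOf C) ∎
  where
  open ≡-Reasoning
  outs = List.map (outside ∷_) (subsets n)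
  ins  = List.map (inside ∷_) (subsets n)

term : R n → R n → Subset n → Subset n → ℚ
term f g C A = sign (inversions A (C ─ A)) ℚ.* (f A ℚ.* g (C ─ A))

-- A subset of `inside ∷ C` contains the first variable or leaves it to the second factor. In the
-- latter case the variable has to pass all of θ_A, which adds ∣ A ∣ inversions; their sign is
-- absorbed by the parity involution on `f`.
*≗⊛ : ∀ (f g : R n) → f * g ≗ f ⊛ g
*≗⊛ f g [] = solve 2 (λ a b → con 1ℚ :* (a :* b) :+ con 0ℚ := a :* b) refl (f []) (g [])
*≗⊛ f g (outside ∷ C) =
  trans (sumBy-subsets-out (term f g (outside ∷ C)) C) (*≗⊛ (part outside f) (part outside g) C)
*≗⊛ f g (inside ∷ C) = begin
  (f * g) (inside ∷ C)
    ≡⟨ sumBy-subsets-in (term f g (inside ∷ C)) C ⟩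
  sumBy (term f g (inside ∷ C) ∘ (outside ∷_)) (subsetsOf C) ℚ.+ (part inside f * part outside g) C
    ≡⟨ cong (ℚ._+ (part inside f * part outside g) C) (sumBy-cong move (subsetsOf C)) ⟩
  (part outside f ̂ * part inside g) C ℚ.+ (part inside f * part outside g) C
    ≡⟨ cong₂ ℚ._+_ (*≗⊛ (part outside f ̂) (part inside g) C) (*≗⊛ (part inside f) (part outside g) C) ⟩
  (f ⊛ g) (inside ∷ C) ∎
  where
  open ≡-Reasoning
  move : term f g (inside ∷ C) ∘ (outside ∷_) ≗ term (part outside f ̂) (part inside g) C
  move A = trans
    (cong (ℚ._* (f (outside ∷ A) ℚ.* g (inside ∷ (C ─ A)))) (sign-+ ∣ A ∣ (inversions A (C ─ A))))
    (solve 4 (λ s t a b → s :* t :* (a :* b) := t :* (s :* a :* b)) refl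
      (sign ∣ A ∣) (sign (inversions A (C ─ A))) (f (outside ∷ A)) (g (inside ∷ (C ─ A))))

⊛-cong : ∀ {f f′ g g′ : R n} → f ≗ f′ → g ≗ g′ → f ⊛ g ≗ f′ ⊛ g′
⊛-cong p q []            = cong₂ ℚ._*_ (p []) (q [])
⊛-cong p q (outside ∷ C) = ⊛-cong (p ∘ (outside ∷_)) (q ∘ (outside ∷_)) C
⊛-cong p q (inside  ∷ C) = cong₂ ℚ._+_
  (⊛-cong (λ A → cong (sign ∣ A ∣ ℚ.*_) (p (outside ∷ A))) (q ∘ (inside ∷_)) C)
  (⊛-cong (p ∘ (inside ∷_)) (q ∘ (outside ∷_)) C)

⊛-zeroˡ : ∀ {f : R n} (g : R n) → f ≗ 0ᴿ → f ⊛ g ≗ 0ᴿ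
⊛-zeroˡ g p []            = trans (cong (ℚ._* g []) (p [])) (ℚ.*-zeroˡ (g []))
⊛-zeroˡ g p (outside ∷ C) = ⊛-zeroˡ (part outside g) (p ∘ (outside ∷_)) C
⊛-zeroˡ g p (inside  ∷ C) = cong₂ ℚ._+_
  (⊛-zeroˡ (part inside g) (λ A → trans (cong (sign ∣ A ∣ ℚ.*_) (p (outside ∷ A))) (ℚ.*-zeroʳ (sign ∣ A ∣))) C)
  (⊛-zeroˡ (part outside g) (p ∘ (inside ∷_)) C)

⊛-zeroʳ : ∀ (f : R n) {g : R n} → g ≗ 0ᴿ → f ⊛ g ≗ 0ᴿ
⊛-zeroʳ f p []            = trans (cong (f [] ℚ.*_) (p [])) (ℚ.*-zeroʳ (f []))
⊛-zeroʳ f p (outside ∷ C) = ⊛-zeroʳ (part outside f) (p ∘ (outside ∷_)) C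
⊛-zeroʳ f p (inside  ∷ C) = cong₂ ℚ._+_
  (⊛-zeroʳ (part outside f ̂) (p ∘ (inside ∷_)) C)
  (⊛-zeroʳ (part inside f) (p ∘ (outside ∷_)) C)

⊛-subˡ : ∀ (f f′ g : R n) → (f - f′) ⊛ g ≗ (f ⊛ g) - (f′ ⊛ g)
⊛-subˡ f f′ g [] =
  solve 3 (λ a b d → (a :- b) :* d := a :* d :- b :* d) refl (f []) (f′ []) (g [])
⊛-subˡ f f′ g (outside ∷ C) = ⊛-subˡ (part outside f) (part outside f′) (part outside g) C
⊛-subˡ f f′ g (inside ∷ C) = trans
  (cong₂ ℚ._+_
    (trans (⊛-cong
              (λ A → solve 3 (λ s a b → s :* (a :- b) := s :* a :- s :* b) refl
                       (sign ∣ A ∣) (f (outside ∷ A)) (f′ (outside ∷ A)))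
              (λ _ → refl) C)
           (⊛-subˡ (part outside f ̂) (part outside f′ ̂) (part inside g) C))
    (⊛-subˡ (part inside f) (part inside f′) (part outside g) C))
  (solve 4 (λ p q r s → p :- q :+ (r :- s) := p :+ r :- (q :+ s)) refl
    ((part outside f ̂ ⊛ part inside g) C) ((part outside f′ ̂ ⊛ part inside g) C)
    ((part inside f ⊛ part outside g) C) ((part inside f′ ⊛ part outside g) C))

⊛-subʳ : ∀ (f g g′ : R n) → f ⊛ (g - g′) ≗ (f ⊛ g) - (f ⊛ g′)
⊛-subʳ f g g′ [] =
  solve 3 (λ a b d → d :* (a :- b) := d :* a :- d :* b) refl (g []) (g′ []) (f [])
⊛-subʳ f g g′ (outside ∷ C) = ⊛-subʳ (part outside f) (part outside g) (part outside g′) C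
⊛-subʳ f g g′ (inside ∷ C) = trans
  (cong₂ ℚ._+_
    (⊛-subʳ (part outside f ̂) (part inside g) (part inside g′) C)
    (⊛-subʳ (part inside f) (part outside g) (part outside g′) C))
  (solve 4 (λ p q r s → p :- q :+ (r :- s) := p :+ r :- (q :+ s)) refl
    ((part outside f ̂ ⊛ part inside g) C) ((part outside f ̂ ⊛ part inside g′) C)
    ((part inside f ⊛ part outside g) C) ((part inside f ⊛ part outside g′) C))

⊛-negˡ : ∀ (f g : R n) → (-ᴿ f) ⊛ g ≗ -ᴿ (f ⊛ g)
⊛-negˡ f g A = begin
  ((-ᴿ f) ⊛ g) A               ≡⟨ ⊛-cong (λ B → sym (ℚ.+-identityˡ (ℚ.- f B))) (λ _ → refl) A ⟩
  ((0ᴿ - f) ⊛ g) A             ≡⟨ ⊛-subˡ 0ᴿ f g A ⟩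
  (0ᴿ ⊛ g) A ℚ.- (f ⊛ g) A     ≡⟨ cong (ℚ._- (f ⊛ g) A) (⊛-zeroˡ g (λ _ → refl) A) ⟩
  0ℚ ℚ.- (f ⊛ g) A             ≡⟨ ℚ.+-identityˡ _ ⟩
  ℚ.- (f ⊛ g) A                ∎
  where open ≡-Reasoning

⊛-negʳ : ∀ (f g : R n) → f ⊛ (-ᴿ g) ≗ -ᴿ (f ⊛ g)
⊛-negʳ f g A = begin
  (f ⊛ (-ᴿ g)) A               ≡⟨ ⊛-cong {f = f} (λ _ → refl) (λ B → sym (ℚ.+-identityˡ (ℚ.- g B))) A ⟩
  (f ⊛ (0ᴿ - g)) A             ≡⟨ ⊛-subʳ f 0ᴿ g A ⟩
  (f ⊛ 0ᴿ) A ℚ.- (f ⊛ g) A     ≡⟨ cong (ℚ._- (f ⊛ g) A) (⊛-zeroʳ f (λ _ → refl) A) ⟩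
  0ℚ ℚ.- (f ⊛ g) A             ≡⟨ ℚ.+-identityˡ _ ⟩
  ℚ.- (f ⊛ g) A                ∎
  where open ≡-Reasoning

-- Contraction of the ideal

insertPair : Bool → Bool → Fin (suc n) → Subset n → Subset (suc (suc n))
insertPair x y zero    A       = x ∷ y ∷ A
insertPair x y (suc i) (a ∷ A) = a ∷ insertPair x y i A

-- Contraction by θ_{i+1} - θ_i, followed by θ_i = θ_{i+1} = 0; the sign is
-- the parity of the variables in front.
D : Fin (suc n) → R (suc (suc n)) → R n
D zero    f A             = f (outside ∷ inside ∷ A) ℚ.- f (inside ∷ outside ∷ A)
D (suc i) f (outside ∷ A) = D i (part outside f) A
D (suc i) f (inside  ∷ A) = ℚ.- D i (part inside f) A

-- The substitution θ_i = θ_{i+1} = 0, which acts on the undifferentiated factor in the Leibniz rule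
-- for `D`.
E : Fin (suc n) → R (suc (suc n)) → R n
E i f A = f (insertPair outside outside i A)

∣insertPair∣ : ∀ (i : Fin (suc n)) A → ∣ insertPair outside outside i A ∣ ≡ ∣ A ∣
∣insertPair∣ zero    A             = refl
∣insertPair∣ (suc i) (outside ∷ A) = ∣insertPair∣ i A
∣insertPair∣ (suc i) (inside  ∷ A) = cong suc (∣insertPair∣ i A)

E-̂ : ∀ i (f : R (suc (suc n))) → E i (f ̂) ≗ E i f ̂
E-̂ i f A = cong (λ m → sign m ℚ.* E i f A) (∣insertPair∣ i A)

D-cong : ∀ i {f g : R (suc (suc n))} → f ≗ g → D i f ≗ D i g
D-cong zero    p A             = cong₂ ℚ._-_ (p _) (p _)
D-cong (suc i) p (outside ∷ A) = D-cong i (p ∘ (outside ∷_)) A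
D-cong (suc i) p (inside  ∷ A) = cong ℚ.-_ (D-cong i (p ∘ (inside ∷_)) A)

D-+ : ∀ i (f g : R (suc (suc n))) → D i (f + g) ≗ D i f + D i g
D-+ zero f g A = solve 4 (λ a b c d → a :+ b :- (c :+ d) := a :- c :+ (b :- d)) refl
  (f (outside ∷ inside ∷ A)) (g (outside ∷ inside ∷ A)) (f (inside ∷ outside ∷ A)) (g (inside ∷ outside ∷ A))
D-+ (suc i) f g (outside ∷ A) = D-+ i (part outside f) (part outside g) A
D-+ (suc i) f g (inside  ∷ A) = trans (cong ℚ.-_ (D-+ i (part inside f) (part inside g) A))
  (ℚ.neg-distrib-+ (D i (part inside f) A) (D i (part inside g) A))

D-neg : ∀ i (f : R (suc (suc n))) → D i (-ᴿ f) ≗ -ᴿ D i f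
D-neg zero f A = sym (ℚ.neg-distrib-+ (f (outside ∷ inside ∷ A)) (ℚ.- f (inside ∷ outside ∷ A)))
D-neg (suc i) f (outside ∷ A) = D-neg i (part outside f) A
D-neg (suc i) f (inside  ∷ A) = cong ℚ.-_ (D-neg i (part inside f) A)

-- `D` lowers the degree by one, so it anticommutes with the parity involution.
D-̂ : ∀ i (f : R (suc (suc n))) → D i (f ̂) ≗ -ᴿ (D i f ̂)
D-̂ zero f A =
  solve 3 (λ s a b → (:- s) :* a :- (:- s) :* b := :- (s :* (a :- b))) refl
    (sign ∣ A ∣) (f (outside ∷ inside ∷ A)) (f (inside ∷ outside ∷ A))
D-̂ (suc i) f (outside ∷ A) = D-̂ i (part outside f) A
D-̂ (suc i) f (inside  ∷ A) = cong ℚ.-_ (begin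
  D i (part inside (f ̂)) A
    ≡⟨ D-cong i (λ B → sym (ℚ.neg-distribˡ-* (sign ∣ B ∣) (f (inside ∷ B)))) A ⟩
  D i (-ᴿ (part inside f ̂)) A
    ≡⟨ D-neg i (part inside f ̂) A ⟩
  ℚ.- D i (part inside f ̂) A
    ≡⟨ cong ℚ.-_ (D-̂ i (part inside f) A) ⟩
  ℚ.- (ℚ.- (sign ∣ A ∣ ℚ.* D i (part inside f) A))
    ≡⟨ solve 2 (λ s d → :- (:- (s :* d)) := (:- s) :* (:- d)) refl (sign ∣ A ∣) (D i (part inside f) A) ⟩
  ℚ.- sign ∣ A ∣ ℚ.* (ℚ.- D i (part inside f) A) ∎)
  where open ≡-Reasoning

-- A monomial free of both variables factors only into monomials free of them, so the substitution
-- is multiplicative.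
E-⊛ : ∀ i (f g : R (suc (suc n))) → E i (f ⊛ g) ≗ E i f ⊛ E i g
E-⊛ zero    f g A             = refl
E-⊛ (suc i) f g (outside ∷ A) = E-⊛ i (part outside f) (part outside g) A
E-⊛ (suc i) f g (inside  ∷ A) = cong₂ ℚ._+_
  (trans (E-⊛ i (part outside f ̂) (part inside g) A)
         (⊛-cong (E-̂ i (part outside f)) (λ _ → refl) A))
  (E-⊛ i (part inside f) (part outside g) A)

-- Contraction is an odd derivation: it passes the first factor at the cost of the parity
-- involution. The substitution that follows turns the undifferentiated factor into its image under
-- `E`.
D-⊛ : ∀ i (f g : R (suc (suc n))) → D i (f ⊛ g) ≗ (D i f ⊛ E i g) + (E i f ̂ ⊛ D i g)
D-⊛ zero f g A = begin
  (f₀₀ ̂ ⊛ g₀₁) A ℚ.+ (f₀₁ ⊛ g₀₀) A ℚ.- ((f₀₀ ̂ ⊛ g₁₀) A ℚ.+ (f₁₀ ⊛ g₀₀) A)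
    ≡⟨ solve 4 (λ a b c d → a :+ b :- (c :+ d) := b :- d :+ (a :- c)) refl
        ((f₀₀ ̂ ⊛ g₀₁) A) ((f₀₁ ⊛ g₀₀) A) ((f₀₀ ̂ ⊛ g₁₀) A) ((f₁₀ ⊛ g₀₀) A) ⟩
  (f₀₁ ⊛ g₀₀) A ℚ.- (f₁₀ ⊛ g₀₀) A ℚ.+ ((f₀₀ ̂ ⊛ g₀₁) A ℚ.- (f₀₀ ̂ ⊛ g₁₀) A)
    ≡⟨ cong₂ ℚ._+_ (⊛-subˡ f₀₁ f₁₀ g₀₀ A) (⊛-subʳ (f₀₀ ̂) g₀₁ g₁₀ A) ⟨
  (D zero f ⊛ g₀₀) A ℚ.+ (f₀₀ ̂ ⊛ D zero g) A ∎
  where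
  open ≡-Reasoning
  f₀₀ = part outside (part outside f)
  f₀₁ = part inside (part outside f)
  f₁₀ = part outside (part inside f)
  g₀₀ = part outside (part outside g)
  g₀₁ = part inside (part outside g)
  g₁₀ = part outside (part inside g)
D-⊛ (suc i) f g (outside ∷ A) = D-⊛ i (part outside f) (part outside g) A
D-⊛ (suc i) f g (inside  ∷ A) = begin
  ℚ.- D i ((f₀ ̂ ⊛ g₁) + (f₁ ⊛ g₀)) A
    ≡⟨ cong ℚ.-_ (D-+ i (f₀ ̂ ⊛ g₁) (f₁ ⊛ g₀) A) ⟩
  ℚ.- (D i (f₀ ̂ ⊛ g₁) A ℚ.+ D i (f₁ ⊛ g₀) A)
    ≡⟨ cong ℚ.-_ (cong₂ ℚ._+_ (D-⊛ i (f₀ ̂) g₁ A) (D-⊛ i f₁ g₀ A)) ⟩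
  ℚ.- ((D i (f₀ ̂) ⊛ E i g₁) A ℚ.+ (E i (f₀ ̂) ̂ ⊛ D i g₁) A
       ℚ.+ ((D i f₁ ⊛ E i g₀) A ℚ.+ (E i f₁ ̂ ⊛ D i g₀) A))
    -- `D` anticommutes with the parity involution while `E` commutes with it.
    ≡⟨ cong (λ x → ℚ.- (x ℚ.+ ((D i f₁ ⊛ E i g₀) A ℚ.+ (E i f₁ ̂ ⊛ D i g₀) A)))
        (cong₂ ℚ._+_
          (trans (⊛-cong (D-̂ i f₀) (λ _ → refl) A) (⊛-negˡ (D i f₀ ̂) (E i g₁) A))
          (⊛-cong (λ B → cong (sign ∣ B ∣ ℚ.*_) (E-̂ i f₀ B)) (λ _ → refl) A)) ⟩
  ℚ.- (ℚ.- (D i f₀ ̂ ⊛ E i g₁) A ℚ.+ ((E i f₀ ̂) ̂ ⊛ D i g₁) A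
       ℚ.+ ((D i f₁ ⊛ E i g₀) A ℚ.+ (E i f₁ ̂ ⊛ D i g₀) A))
    ≡⟨ solve 4 (λ a b c d → :- (:- a :+ b :+ (c :+ d)) := a :+ :- c :+ (:- b :+ :- d)) refl
        ((D i f₀ ̂ ⊛ E i g₁) A) (((E i f₀ ̂) ̂ ⊛ D i g₁) A)
        ((D i f₁ ⊛ E i g₀) A) ((E i f₁ ̂ ⊛ D i g₀) A) ⟩
  (D i f₀ ̂ ⊛ E i g₁) A ℚ.+ ℚ.- (D i f₁ ⊛ E i g₀) A
    ℚ.+ (ℚ.- ((E i f₀ ̂) ̂ ⊛ D i g₁) A ℚ.+ ℚ.- (E i f₁ ̂ ⊛ D i g₀) A)
    ≡⟨ cong₂ ℚ._+_
        (cong ((D i f₀ ̂ ⊛ E i g₁) A ℚ.+_) (⊛-negˡ (D i f₁) (E i g₀) A))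
        (cong₂ ℚ._+_
          (⊛-negʳ ((E i f₀ ̂) ̂) (D i g₁) A)
          (trans (⊛-cong (λ B → sym (ℚ.neg-distribˡ-* (sign ∣ B ∣) (E i f₁ B))) (λ _ → refl) A)
                 (⊛-negˡ (E i f₁ ̂) (D i g₀) A))) ⟨
  (D (suc i) f ⊛ E (suc i) g) (inside ∷ A) ℚ.+ (E (suc i) f ̂ ⊛ D (suc i) g) (inside ∷ A) ∎
  where
  open ≡-Reasoning
  f₀ = part outside f
  f₁ = part inside f
  g₀ = part outside g
  g₁ = part inside g

-- The coefficients of `F r` depend on size alone, and `D` subtracts the coefficients at two sets of
-- equal size.
D-F : ∀ i r → D {n} i (F r) ≗ 0ᴿ
D-F i r A = go i (λ B C eq → cong (λ m → if does (m ℕ.≟ r) then 1ℚ else 0ℚ) eq) A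
  where
  -- Stated for all `f` with this symmetry, because splitting off a variable shifts the size and
  -- leaves the family `F r` with its fixed r.
  go : ∀ {n} i {f : R (suc (suc n))} → (∀ B C → ∣ B ∣ ≡ ∣ C ∣ → f B ≡ f C) → D i f ≗ 0ᴿ
  go zero {f} sym-f A =
    trans (cong (ℚ._- f (inside ∷ outside ∷ A)) (sym-f (outside ∷ inside ∷ A) (inside ∷ outside ∷ A) refl))
          (ℚ.+-inverseʳ (f (inside ∷ outside ∷ A)))
  go (suc i) sym-f (outside ∷ A) = go i (λ B C → sym-f (outside ∷ B) (outside ∷ C)) A
  go (suc i) sym-f (inside  ∷ A) =
    cong ℚ.-_ (go i (λ B C eq → sym-f (inside ∷ B) (inside ∷ C) (cong suc eq)) A)

E-F : ∀ i r → E {n} i (F r) ≗ F r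
E-F i r A = cong (λ m → if does (m ℕ.≟ r) then 1ℚ else 0ℚ) (∣insertPair∣ i A)

F-vanishes : ∀ {r} → n ℕ.< r → F {n} r ≗ 0ᴿ
F-vanishes {r = r} n<r A =
  cong (λ b → if b then 1ℚ else 0ℚ) (dec-false (∣ A ∣ ℕ.≟ r) λ { refl → ℕ.≤⇒≯ (∣p∣≤n A) n<r })

-- Constants and the parity involution

scalar : ℚ → R n
scalar c []            = c
scalar c (outside ∷ A) = scalar c A
scalar c (inside  ∷ A) = 0ℚ

scalar-̂ : ∀ c → scalar {n} c ̂ ≗ scalar c
scalar-̂ c []            = ℚ.*-identityˡ c
scalar-̂ c (outside ∷ A) = scalar-̂ c A
scalar-̂ c (inside  ∷ A) = ℚ.*-zeroʳ (ℚ.- sign ∣ A ∣)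

scalar-⊛ : ∀ c (f : R n) → scalar c ⊛ f ≗ c • f
scalar-⊛ c f []            = refl
scalar-⊛ c f (outside ∷ A) = scalar-⊛ c (part outside f) A
scalar-⊛ c f (inside  ∷ A) = begin
  (scalar c ̂ ⊛ part inside f) A ℚ.+ (0ᴿ ⊛ part outside f) A
    ≡⟨ cong₂ ℚ._+_ (⊛-cong (scalar-̂ c) (λ _ → refl) A) (⊛-zeroˡ (part outside f) (λ _ → refl) A) ⟩
  (scalar c ⊛ part inside f) A ℚ.+ 0ℚ
    ≡⟨ ℚ.+-identityʳ _ ⟩
  (scalar c ⊛ part inside f) A
    ≡⟨ scalar-⊛ c (part inside f) A ⟩
  c ℚ.* f (inside ∷ A) ∎
  where open ≡-Reasoning

̂-⊛ : ∀ (f g : R n) → (f ⊛ g) ̂ ≗ f ̂ ⊛ g ̂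
̂-⊛ f g [] = solve 2 (λ a b → con 1ℚ :* (a :* b) := con 1ℚ :* a :* (con 1ℚ :* b)) refl (f []) (g [])
̂-⊛ f g (outside ∷ A) = ̂-⊛ (part outside f) (part outside g) A
̂-⊛ f g (inside  ∷ A) = begin
  ℚ.- sign ∣ A ∣ ℚ.* ((f₀ ̂ ⊛ g₁) A ℚ.+ (f₁ ⊛ g₀) A)
    ≡⟨ solve 3 (λ s a b → (:- s) :* (a :+ b) := :- (s :* a) :+ :- (s :* b)) refl
        (sign ∣ A ∣) ((f₀ ̂ ⊛ g₁) A) ((f₁ ⊛ g₀) A) ⟩
  ℚ.- ((f₀ ̂ ⊛ g₁) ̂) A ℚ.+ ℚ.- ((f₁ ⊛ g₀) ̂) A
    ≡⟨ cong₂ (λ x y → ℚ.- x ℚ.+ ℚ.- y) (̂-⊛ (f₀ ̂) g₁ A) (̂-⊛ f₁ g₀ A) ⟩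
  ℚ.- ((f₀ ̂) ̂ ⊛ g₁ ̂) A ℚ.+ ℚ.- (f₁ ̂ ⊛ g₀ ̂) A
    ≡⟨ cong₂ ℚ._+_
        (trans (⊛-cong {f = (f₀ ̂) ̂} (λ _ → refl) (λ B → sym (ℚ.neg-distribˡ-* (sign ∣ B ∣) (g₁ B))) A) (⊛-negʳ ((f₀ ̂) ̂) (g₁ ̂) A))
        (trans (⊛-cong (λ B → sym (ℚ.neg-distribˡ-* (sign ∣ B ∣) (f₁ B))) (λ _ → refl) A) (⊛-negˡ (f₁ ̂) (g₀ ̂) A)) ⟨
  (f ̂ ⊛ g ̂) (inside ∷ A) ∎
  where
  open ≡-Reasoning
  f₀ = part outside f
  f₁ = part inside f
  g₀ = part outside g
  g₁ = part inside g

-- `F r` is homogeneous of degree r. Hence the parity involution maps each generator to a multiple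
-- of itself and preserves the ideal.
F-̂ : ∀ r → F {n} r ̂ ≗ sign r • F r
F-̂ r A with ∣ A ∣ ℕ.≟ r
... | yes refl = refl
... | no ∣A∣≢r = trans (vanish (sign ∣ A ∣)) (sym (vanish (sign r)))
  where
  vanish : ∀ c → c ℚ.* F r A ≡ 0ℚ
  vanish c = trans
    (cong (λ b → c ℚ.* (if b then 1ℚ else 0ℚ)) (dec-false (∣ A ∣ ℕ.≟ r) ∣A∣≢r))
    (ℚ.*-zeroʳ c)

-- Maps that preserve the ideal

F∈I : ∀ {r} → 1 ℕ.≤ r → I n (F r)
F∈I {n} {r} 1≤r with r ℕ.≤? n
... | yes r≤n = generator (r , 1≤r , r≤n , λ _ → refl)
-- This case arises because `E` keeps r while it removes two variables.
... | no r≰n  = respects (λ A → sym (F-vanishes (ℕ.≰⇒> r≰n) A)) zeroᴵ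

-- A homomorphism that sends each `F r` to `F r` in two variables fewer.
E-ideal : ∀ i {f} → I (suc (suc n)) f → I n (E i f)
E-ideal i (generator (r , 1≤r , _ , p)) = respects (λ A → sym (trans (p _) (E-F i r A))) (F∈I 1≤r)
E-ideal i zeroᴵ          = zeroᴵ
E-ideal i (plus p q)     = plus (E-ideal i p) (E-ideal i q)
E-ideal i (timesˡ h {f} p) =
  respects (λ A → trans (*≗⊛ (E i h) (E i f) A) (sym (trans (*≗⊛ h f _) (E-⊛ i h f A))))
    (timesˡ (E i h) (E-ideal i p))
E-ideal i (timesʳ h {f} p) =
  respects (λ A → trans (*≗⊛ (E i f) (E i h) A) (sym (trans (*≗⊛ f h _) (E-⊛ i f h A))))
    (timesʳ (E i h) (E-ideal i p))
E-ideal i (respects p q) = respects (λ A → p _) (E-ideal i q)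

-- A scalar multiple is the product with a constant polynomial.
•-ideal : ∀ c {f} → I n f → I n (c • f)
•-ideal c {f} p = respects (λ A → trans (*≗⊛ (scalar c) f A) (scalar-⊛ c f A)) (timesˡ (scalar c) p)

̂-ideal : ∀ {f} → I n f → I n (f ̂)
̂-ideal (generator (r , 1≤r , _ , p)) =
  respects (λ A → trans (sym (F-̂ r A)) (cong (sign ∣ A ∣ ℚ.*_) (sym (p A)))) (•-ideal (sign r) (F∈I 1≤r))
̂-ideal zeroᴵ = respects (λ A → sym (ℚ.*-zeroʳ (sign ∣ A ∣))) zeroᴵ
̂-ideal (plus {f} {g} p q) =
  respects (λ A → sym (ℚ.*-distribˡ-+ (sign ∣ A ∣) (f A) (g A))) (plus (̂-ideal p) (̂-ideal q))
̂-ideal (timesˡ h {f} p) =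
  respects (λ A → trans (*≗⊛ (h ̂) (f ̂) A) (sym (trans (cong (sign ∣ A ∣ ℚ.*_) (*≗⊛ h f A)) (̂-⊛ h f A))))
    (timesˡ (h ̂) (̂-ideal p))
̂-ideal (timesʳ h {f} p) =
  respects (λ A → trans (*≗⊛ (f ̂) (h ̂) A) (sym (trans (cong (sign ∣ A ∣ ℚ.*_) (*≗⊛ f h A)) (̂-⊛ f h A))))
    (timesʳ (h ̂) (̂-ideal p))
̂-ideal (respects p q) = respects (λ A → cong (sign ∣ A ∣ ℚ.*_) (p A)) (̂-ideal q)

D-* : ∀ i (f g : R (suc (suc n))) → D i (f * g) ≗ (D i f * E i g) + (E i f ̂ * D i g)
D-* i f g A = trans (D-cong i (*≗⊛ f g) A) (trans (D-⊛ i f g A)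
  (sym (cong₂ ℚ._+_ (*≗⊛ (D i f) (E i g) A) (*≗⊛ (E i f ̂) (D i g) A))))

D-0 : ∀ i → D {n} i 0ᴿ ≗ 0ᴿ
D-0 zero    A             = refl
D-0 (suc i) (outside ∷ A) = D-0 i A
D-0 (suc i) (inside  ∷ A) = cong ℚ.-_ (D-0 i A)

D-ideal : ∀ i {f} → I (suc (suc n)) f → I n (D i f)
D-ideal i (generator (r , _ , _ , p)) = respects (λ A → sym (trans (D-cong i p A) (D-F i r A))) zeroᴵ
D-ideal i zeroᴵ            = respects (λ A → sym (D-0 i A)) zeroᴵ
D-ideal i (plus {f} {g} p q) = respects (λ A → sym (D-+ i f g A)) (plus (D-ideal i p) (D-ideal i q))
D-ideal i (timesˡ h {f} p) = respects (λ A → sym (D-* i h f A))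
  (plus (timesˡ (D i h) (E-ideal i p)) (timesˡ (E i h ̂) (D-ideal i p)))
-- In the second summand the factor from the ideal carries both `E` and the parity involution.
D-ideal i (timesʳ h {f} p) = respects (λ A → sym (D-* i f h A))
  (plus (timesʳ (E i h) (D-ideal i p)) (timesʳ (D i h) (̂-ideal (E-ideal i p))))
D-ideal i (respects p q)   = respects (D-cong i p) (D-ideal i q)

⊛-⊥ : ∀ (f g : R n) → (f ⊛ g) ⊥ ≡ f ⊥ ℚ.* g ⊥
⊛-⊥ {zero}  f g = refl
⊛-⊥ {suc n} f g = ⊛-⊥ (part outside f) (part outside g)

-- The generators have positive degree, and constant terms multiply.
I-constantTerm : ∀ {f} → I n f → f ⊥ ≡ 0ℚ
I-constantTerm {n} (generator (suc r , _ , _ , p)) = trans (p ⊥)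
  (cong (λ m → if does (m ℕ.≟ suc r) then 1ℚ else 0ℚ) (∣⊥∣≡0 n))
I-constantTerm zeroᴵ      = refl
I-constantTerm (plus p q) = cong₂ ℚ._+_ (I-constantTerm p) (I-constantTerm q)
I-constantTerm (timesˡ h {f} p) = trans (*≗⊛ h f ⊥) (trans (⊛-⊥ h f)
  (trans (cong (h ⊥ ℚ.*_) (I-constantTerm p)) (ℚ.*-zeroʳ (h ⊥))))
I-constantTerm (timesʳ h {f} p) = trans (*≗⊛ f h ⊥) (trans (⊛-⊥ f h)
  (trans (cong (ℚ._* h ⊥) (I-constantTerm p)) (ℚ.*-zeroˡ (h ⊥))))
I-constantTerm (respects p q) = trans (sym (p ⊥)) (I-constantTerm q)

-- Ballot sequences are not leading

-- Ballot h A says that 0^h A is a ballot sequence.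
data Ballot : ∀ {n} → ℕ → Subset n → Set where
  []   : ∀ {h} → Ballot h []
  up   : ∀ {h} {A : Subset n} → Ballot (suc h) A → Ballot h (outside ∷ A)
  down : ∀ {h} {A : Subset n} → Ballot h A → Ballot (suc h) (inside ∷ A)

-- One step of the descent: the end 0^m, or a removable pair 01. The equations are arguments because
-- `⊥` and `insertPair` are functions, which do not unify well as indices.
data Reduces (h : ℕ) : ∀ {n} → Subset n → Set where
  zeros : {A : Subset n} → A ≡ ⊥ → Reduces h A
  pair  : ∀ i {A : Subset n} {B} → Ballot h A → B ≡ insertPair outside inside i A → Reduces h B

-- The first 1 after the leading 0s has a 0 to its left, and removing this pair leaves the excess of
-- 0s over 1s behind it unchanged. Without a 1 the string is 0^m.
ballot-reduces-up : ∀ {h} {A : Subset n} → Ballot h (outside ∷ A) → Reduces h (outside ∷ A)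
ballot-reduces-up (up [])       = zeros refl
ballot-reduces-up (up (down b)) = pair zero b refl
ballot-reduces-up (up b@(up _)) with ballot-reduces-up b
... | zeros p     = zeros (cong (outside ∷_) p)
... | pair i b′ p = pair (suc i) (up b′) (cong (outside ∷_) p)

ballot-reduces : ∀ {A : Subset n} → Ballot 0 A → Reduces 0 A
ballot-reduces []       = zeros refl
ballot-reduces b@(up _) = ballot-reduces-up b

-- The pair `x`, `not x` is 01 or 10, the two exponents from which `D` is formed. A difference
-- before the pair decides both comparisons; otherwise 10 would exceed 01, and equal pairs cancel.
insertPair-≤ : ∀ x i {A B : Subset n} →
  insertPair x (not x) i B ≤ˡᵉˣ insertPair outside inside i A → B ≤ˡᵉˣ A
insertPair-≤ false zero    (next _ (next _ p)) = p
insertPair-≤ true  zero    (next () _)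
insertPair-≤ x (suc i) {_ ∷ _} {_ ∷ _} (this b<a _) = this b<a refl
insertPair-≤ x (suc i) {_ ∷ _} {_ ∷ _} (next eq p)  = next eq (insertPair-≤ x i p)

-- Forces the coefficient at u10v to vanish, so that only the one at u01v survives in `D`.
insertPair-≰ : ∀ i {A : Subset n} →
  ¬ insertPair inside outside i A ≤ˡᵉˣ insertPair outside inside i A
insertPair-≰ zero (next () _)
insertPair-≰ (suc i) {false ∷ _} (this () _)
insertPair-≰ (suc i) {true  ∷ _} (this () _)
insertPair-≰ (suc i) {_ ∷ _} (next _ p) = insertPair-≰ i p

D-zero : ∀ i (f : R (suc (suc n))) A → f (insertPair outside inside i A) ≡ 0ℚ →
         f (insertPair inside outside i A) ≡ 0ℚ → D i f A ≡ 0ℚ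
D-zero zero    f A             p q = cong₂ ℚ._-_ p q
D-zero (suc i) f (outside ∷ A) p q = D-zero i (part outside f) A p q
D-zero (suc i) f (inside  ∷ A) p q = cong ℚ.-_ (D-zero i (part inside f) A p q)

D-zero⁻¹ : ∀ i (f : R (suc (suc n))) A → D i f A ≡ 0ℚ →
           f (insertPair inside outside i A) ≡ 0ℚ → f (insertPair outside inside i A) ≡ 0ℚ
D-zero⁻¹ zero f A p q = trans
  (solve 2 (λ a b → a := a :- b :+ b) refl (f (outside ∷ inside ∷ A)) (f (inside ∷ outside ∷ A)))
  (cong₂ ℚ._+_ p q)
D-zero⁻¹ (suc i) f (outside ∷ A) p q = D-zero⁻¹ i (part outside f) A p q
D-zero⁻¹ (suc i) f (inside  ∷ A) p q = D-zero⁻¹ i (part inside f) A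
  (trans (solve 1 (λ x → x := :- (:- x)) refl (D i (part inside f) A)) (cong ℚ.-_ p)) q

D-support : ∀ i (f : R (suc (suc n))) {A} →
  (∀ B → Occurs f B → B ≤ˡᵉˣ insertPair outside inside i A) →
  ∀ B → Occurs (D i f) B → B ≤ˡᵉˣ A
D-support i f supp B DfB≢0 with f (insertPair outside inside i B) ℚ.≟ 0ℚ
... | no fB≢0  = insertPair-≤ outside i (supp _ fB≢0)
... | yes fB≡0 with f (insertPair inside outside i B) ℚ.≟ 0ℚ
...   | no fB≢0   = insertPair-≤ inside i (supp _ fB≢0)
...   | yes fB≡0′ = contradiction (D-zero i f B fB≡0 fB≡0′) DfB≢0

-- Induction in steps of two variables. The support is only bounded by `A`, with no demand that `A`
-- occurs: in this form the hypothesis passes from `f` to `D i f`, and the vanishing passes back.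
ballot-coefficient : ∀ {f : R n} {A} → I n f → Ballot 0 A →
                     (∀ B → Occurs f B → B ≤ˡᵉˣ A) → f A ≡ 0ℚ
ballot-coefficient {f = f} f∈I b supp with ballot-reduces b
... | zeros refl = I-constantTerm f∈I
... | pair i {A} b′ refl with f (insertPair inside outside i A) ℚ.≟ 0ℚ
...   | no ≢0  = contradiction (supp _ ≢0) (insertPair-≰ i)
...   | yes ≡0 = D-zero⁻¹ i f A
        (ballot-coefficient (D-ideal i f∈I) b′ (D-support i f supp)) ≡0

-- Sequences that break the ballot condition only at the rightmost 1

-- Min h A says that 0^h A breaks the ballot condition exactly at its
-- rightmost 1.
data Min : ∀ {n} → ℕ → Subset n → Set where
  stop : {A : Subset n} → A ≡ ⊥ → Min 0 (inside ∷ A)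
  up   : ∀ {h} {A : Subset n} → Min (suc h) A → Min h (outside ∷ A)
  down : ∀ {h} {A : Subset n} → Min h A → Min (suc h) (inside ∷ A)

ballot-or-min : ∀ h (A : Subset n) → Ballot h A ⊎ ∃[ B ] (Min h B × B ⊆ A)
ballot-or-min h [] = inj₁ []
ballot-or-min h (outside ∷ A) with ballot-or-min (suc h) A
... | inj₁ b             = inj₁ (up b)
... | inj₂ (B , m , B⊆A) = inj₂ (outside ∷ B , up m , out⊆ B⊆A)
-- With no 0s in excess this 1 is the first break; zeros after it make it the rightmost 1.
ballot-or-min zero (inside ∷ A) = inj₂ (inside ∷ ⊥ , stop refl , in⊆in ⊥⊆)
ballot-or-min (suc h) (inside ∷ A) with ballot-or-min h A
... | inj₁ b             = inj₁ (down b)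
... | inj₂ (B , m , B⊆A) = inj₂ (inside ∷ B , down m , in⊆in B⊆A)

min? : ∀ h (A : Subset n) → Dec (Min h A)
min? h       []            = no λ ()
min? h       (outside ∷ A) = map′ up (λ { (up m) → m }) (min? (suc h) A)
min? zero    (inside  ∷ A) = map′ stop (λ { (stop p) → p }) (≡-dec Bool._≟_ A ⊥)
min? (suc h) (inside  ∷ A) = map′ down (λ { (down m) → m }) (min? h A)

in⊈out : {A B : Subset n} → ¬ (inside ∷ A ⊆ outside ∷ B)
in⊈out p with () ← p here

min⊈⊥ : ∀ {h} {A : Subset n} → Min h A → ¬ (A ⊆ ⊥)
min⊈⊥ (stop _) p = in⊈out p
min⊈⊥ (up m)   p = min⊈⊥ m (drop-∷-⊆ p)
min⊈⊥ (down m) p = in⊈out p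

-- Every prefix of `B` has all the 1s of `A`, so its excess h′ of 0s stays at most h. Once `A` has a
-- 0 where `B` has a 1 the inequality is strict from there on; the conclusion includes h = h′ so
-- that the recursion refutes this case.
min-antichain : ∀ {h h′} {A B : Subset n} → h′ ℕ.≤ h → Min h A → Min h′ B → A ⊆ B → h ≡ h′ × A ≡ B
min-antichain le (stop refl) (stop refl) s = refl , refl
min-antichain le (stop _) (up _) s = ⊥-elim (in⊈out s)
min-antichain le (up m) (stop refl) s = ⊥-elim (min⊈⊥ m (drop-∷-⊆ s))
min-antichain le (up m) (up m′) s with min-antichain (s≤s le) m m′ (drop-∷-⊆ s)
... | refl , refl = refl , refl
-- The excess rises for `A` and falls for `B`; the recursive equality h + 1 = h′ - 1 contradicts h′
-- ≤ h.
min-antichain {h = h} le (up m) (down m′) s with min-antichain (ℕ.≤-trans (ℕ.<⇒≤ le) (ℕ.n≤1+n h)) m m′ (drop-∷-⊆ s)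
... | refl , _ = contradiction le (ℕ.<⇒≱ (ℕ.m≤n⇒m≤1+n ℕ.≤-refl))
min-antichain le (down m) (stop refl) s = ⊥-elim (min⊈⊥ m (drop-∷-⊆ s))
min-antichain le (down m) (up _) s = ⊥-elim (in⊈out s)
min-antichain (s≤s le) (down m) (down m′) s with min-antichain le m m′ (drop-∷-⊆ s)
... | refl , refl = refl , refl

-- A break of 0^h α, where the position in α moves by h. For h = 0 it computes to `BreaksAt`.
BreaksAtʰ : ℕ → Subset n → Fin n → Set
BreaksAtʰ h α i = h ℕ.+ suc (toℕ i) ℕ.< 2 ℕ.* partialSum α i

OnlyBreaksʰ : ℕ → Subset n → Set
OnlyBreaksʰ h α = ∃[ i ] (IsRightmostOne α i × (∀ j → BreaksAtʰ h α j ⇔ j ≡ i))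

breaks-out : ∀ h (α : Subset n) i → BreaksAtʰ h (outside ∷ α) (suc i) ≡ BreaksAtʰ (suc h) α i
breaks-out h α i = cong (ℕ._< 2 ℕ.* partialSum α i) (ℕ.+-suc h (suc (toℕ i)))

-- Both sides grow by 2: the left by the shifted position and the larger h, the right by twice the
-- leading 1.
breaks-in : ∀ h (α : Subset n) i → BreaksAtʰ (suc h) (inside ∷ α) (suc i) ⇔ BreaksAtʰ h α i
breaks-in h α i = mk⇔
  (λ p → ℕ.s<s⁻¹ (ℕ.s<s⁻¹ (subst₂ ℕ._<_ l r p)))
  (λ p → subst₂ ℕ._<_ (sym l) (sym r) (ℕ.s<s (ℕ.s<s p)))
  where
  l = cong suc (ℕ.+-suc h (suc (toℕ i)))
  r = ℕ.*-suc 2 (partialSum α i)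

¬breaks-out : ∀ h (α : Subset n) → ¬ BreaksAtʰ h (outside ∷ α) zero
¬breaks-out h α ()

¬breaks-in : ∀ h (α : Subset n) → ¬ BreaksAtʰ (suc h) (inside ∷ α) zero
¬breaks-in h α p with () ← ℕ.s<s⁻¹ (subst (ℕ._< 1) (ℕ.+-comm h 1) (ℕ.s<s⁻¹ p))

rightmost-∷ : ∀ {a} {α : Subset n} {i} → IsRightmostOne α i → IsRightmostOne (a ∷ α) (suc i)
rightmost-∷ (one , rest) = one , λ { (suc j) (s≤s i<j) → rest j i<j }

rightmost-∷⁻¹ : ∀ {a} {α : Subset n} {i} → IsRightmostOne (a ∷ α) (suc i) → IsRightmostOne α i
rightmost-∷⁻¹ (one , rest) = one , λ j i<j → rest (suc j) (s≤s i<j)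

partialSum-⊥ : ∀ (i : Fin n) → partialSum ⊥ i ≡ 0
partialSum-⊥ zero    = refl
partialSum-⊥ (suc i) = partialSum-⊥ i

lookup-⊥⁻¹ : ∀ {A : Subset n} → (∀ i → lookup A i ≡ false) → A ≡ ⊥
lookup-⊥⁻¹ {A = []}    p = refl
lookup-⊥⁻¹ {A = x ∷ A} p = cong₂ _∷_ (p zero) (lookup-⊥⁻¹ (p ∘ suc))

min⇒onlyBreaks : ∀ {h} {A : Subset n} → Min h A → OnlyBreaksʰ h A
min⇒onlyBreaks (stop refl) = zero , (refl , λ { (suc j) _ → lookup-replicate j outside }) , λ where
  zero    → mk⇔ (λ _ → refl) (λ _ → ℕ.≤-refl)
  (suc j) → mk⇔
    -- The partial sum stays 1, and twice it exceeds no position from the second on.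
    (λ p → contradiction (subst (λ m → suc (suc (toℕ j)) ℕ.< 2 ℕ.* suc m) (partialSum-⊥ j) p) λ { (s≤s (s≤s ())) })
    (λ ())
min⇒onlyBreaks (up {h = h} {A} m) with i , r , only ← min⇒onlyBreaks m =
  suc i , rightmost-∷ r , λ where
    zero    → mk⇔ (λ p → contradiction p (¬breaks-out h A)) (λ ())
    (suc j) → mk⇔
      (cong suc ∘ Equivalence.to (only j) ∘ subst id (breaks-out h A j))
      (λ { refl → subst id (sym (breaks-out h A j)) (Equivalence.from (only j) refl) })
min⇒onlyBreaks (down {h = h} {A} m) with i , r , only ← min⇒onlyBreaks m =
  suc i , rightmost-∷ r , λ where
    zero    → mk⇔ (λ p → contradiction p (¬breaks-in h A)) (λ ())
    (suc j) → mk⇔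
      (cong suc ∘ Equivalence.to (only j) ∘ Equivalence.to (breaks-in h A j))
      (λ { refl → Equivalence.from (breaks-in h A j) (Equivalence.from (only j) refl) })

onlyBreaks⇒min : ∀ h (A : Subset n) → OnlyBreaksʰ h A → Min h A
onlyBreaks⇒min h (outside ∷ A) (suc i , r , only) =
  up (onlyBreaks⇒min (suc h) A (i , rightmost-∷⁻¹ r , λ j → mk⇔
    (λ p → Fin.suc-injective (Equivalence.to (only (suc j)) (subst id (sym (breaks-out h A j)) p)))
    (λ { refl → subst id (breaks-out h A j) (Equivalence.from (only (suc j)) refl) })))
-- For h = 0 the leading 1 is a break, so it has to be the only one.
onlyBreaks⇒min zero (inside ∷ A) (i , (_ , rest) , only)
  with refl ← Equivalence.to (only zero) ℕ.≤-refl =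
  stop (lookup-⊥⁻¹ (λ j → rest (suc j) (s≤s z≤n)))
onlyBreaks⇒min (suc h) (inside ∷ A) (zero , _ , only) =
  contradiction (Equivalence.from (only zero) refl) (¬breaks-in h A)
onlyBreaks⇒min (suc h) (inside ∷ A) (suc i , r , only) =
  down (onlyBreaks⇒min h A (i , rightmost-∷⁻¹ r , λ j → mk⇔
    (λ p → Fin.suc-injective (Equivalence.to (only (suc j)) (Equivalence.from (breaks-in h A j) p)))
    (λ { refl → Equivalence.to (breaks-in h A j) (Equivalence.from (only (suc j)) refl) })))

-- Leading monomials of the G_α

monomial-⊥ : monomial {n} ⊥ ≗ scalar 1ℚ
monomial-⊥ []            = refl
monomial-⊥ (outside ∷ A) = monomial-⊥ A
monomial-⊥ (inside  ∷ A) = refl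

θ-̂ : ∀ (i : Fin n) → θ i ̂ ≗ -ᴿ θ i
θ-̂ zero    (outside ∷ A) = ℚ.*-zeroʳ (sign ∣ A ∣)
θ-̂ zero    (inside  ∷ A) = begin
  ℚ.- sign ∣ A ∣ ℚ.* monomial ⊥ A      ≡⟨ ℚ.neg-distribˡ-* (sign ∣ A ∣) (monomial ⊥ A) ⟨
  ℚ.- (sign ∣ A ∣ ℚ.* monomial ⊥ A)    ≡⟨ cong (λ x → ℚ.- (sign ∣ A ∣ ℚ.* x)) (monomial-⊥ A) ⟩
  ℚ.- (scalar 1ℚ ̂) A                   ≡⟨ cong ℚ.-_ (scalar-̂ 1ℚ A) ⟩
  ℚ.- scalar 1ℚ A                      ≡⟨ cong ℚ.-_ (monomial-⊥ A) ⟨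
  ℚ.- monomial ⊥ A                     ∎
  where open ≡-Reasoning
θ-̂ (suc i) (outside ∷ A) = θ-̂ i A
θ-̂ (suc i) (inside  ∷ A) = ℚ.*-zeroʳ (ℚ.- sign ∣ A ∣)

θ-zero-out : ∀ (f : R (suc n)) → part outside (θ zero * f) ≗ 0ᴿ
θ-zero-out f A = trans (*≗⊛ (θ zero) f (outside ∷ A)) (⊛-zeroˡ (part outside f) (λ _ → refl) A)

θ-zero-in : ∀ (f : R (suc n)) → part inside (θ zero * f) ≗ part outside f
θ-zero-in f A = begin
  (θ zero * f) (inside ∷ A)
    ≡⟨ *≗⊛ (θ zero) f (inside ∷ A) ⟩
  ((0ᴿ ̂) ⊛ part inside f) A ℚ.+ (monomial ⊥ ⊛ part outside f) A
    ≡⟨ cong₂ ℚ._+_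
        (⊛-zeroˡ (part inside f) (λ B → ℚ.*-zeroʳ (sign ∣ B ∣)) A)
        (trans (⊛-cong monomial-⊥ (λ _ → refl) A) (scalar-⊛ 1ℚ (part outside f) A)) ⟩
  0ℚ ℚ.+ 1ℚ ℚ.* f (outside ∷ A)
    ≡⟨ solve 1 (λ x → con 0ℚ :+ con 1ℚ :* x := x) refl (f (outside ∷ A)) ⟩
  f (outside ∷ A) ∎
  where open ≡-Reasoning

θ-suc-out : ∀ i (f : R (suc n)) → part outside (θ (suc i) * f) ≗ θ i * part outside f
θ-suc-out i f A = trans (*≗⊛ (θ (suc i)) f (outside ∷ A)) (sym (*≗⊛ (θ i) (part outside f) A))

-- The sign comes from moving the first variable to the front past θ_{i+1}.
θ-suc-in : ∀ i (f : R (suc n)) → part inside (θ (suc i) * f) ≗ -ᴿ (θ i * part inside f)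
θ-suc-in i f A = begin
  (θ (suc i) * f) (inside ∷ A)
    ≡⟨ *≗⊛ (θ (suc i)) f (inside ∷ A) ⟩
  (θ i ̂ ⊛ part inside f) A ℚ.+ (0ᴿ ⊛ part outside f) A
    ≡⟨ cong₂ ℚ._+_
        (trans (⊛-cong (θ-̂ i) (λ _ → refl) A) (⊛-negˡ (θ i) (part inside f) A))
        (⊛-zeroˡ (part outside f) (λ _ → refl) A) ⟩
  ℚ.- (θ i ⊛ part inside f) A ℚ.+ 0ℚ
    ≡⟨ ℚ.+-identityʳ _ ⟩
  ℚ.- (θ i ⊛ part inside f) A
    ≡⟨ cong ℚ.-_ (*≗⊛ (θ i) (part inside f) A) ⟨
  ℚ.- (θ i * part inside f) A ∎
  where open ≡-Reasoning

*-congʳ : ∀ (f : R n) {g g′ : R n} → g ≗ g′ → f * g ≗ f * g′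
*-congʳ f {g} {g′} p A = trans (*≗⊛ f g A) (trans (⊛-cong {f = f} (λ _ → refl) p A) (sym (*≗⊛ f g′ A)))

*-zeroʳ : ∀ (f : R n) {g : R n} → g ≗ 0ᴿ → f * g ≗ 0ᴿ
*-zeroʳ f {g} p A = trans (*≗⊛ f g A) (⊛-zeroʳ f p A)

∣∷ʳ∣ : ∀ (u : Subset k) b → ∣ u ∷ʳ b ∣ ≡ bit b ℕ.+ ∣ u ∣
∣∷ʳ∣ []            true  = refl
∣∷ʳ∣ []            false = refl
∣∷ʳ∣ (outside ∷ u) b     = ∣∷ʳ∣ u b
∣∷ʳ∣ (inside  ∷ u) b     = trans (cong suc (∣∷ʳ∣ u b)) (sym (ℕ.+-suc (bit b) ∣ u ∣))

-- Since u is stored reversed, u ∷ʳ b is the string b u of the mathematics.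
Gᵣ-in-in : ∀ (p : suc k ℕ.≤ suc n) (q : k ℕ.≤ n) u s →
           part inside (Gᵣ p (u ∷ʳ inside) s) ≗ Gᵣ q u s
-- The coefficient of θ₁ in F_{1^{s+1}} is F_{1^s} in the remaining variables.
Gᵣ-in-in p q []            s       A = refl
Gᵣ-in-in p q (true  ∷ u) s       A = Gᵣ-in-in _ _ u (suc s) A
Gᵣ-in-in p q (false ∷ u) zero    A = Gᵣ-in-in _ _ u zero A
Gᵣ-in-in p q (false ∷ u) (suc s) A = cong₂ ℚ._-_ (Gᵣ-in-in _ _ u (suc s) A) (begin
  sign ∣ u ∷ʳ inside ∣ ℚ.* (θ (suc i) * g) (inside ∷ A)
    ≡⟨ cong₂ (λ m x → sign m ℚ.* x) (∣∷ʳ∣ u inside) (θ-suc-in i g A) ⟩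
  ℚ.- sign ∣ u ∣ ℚ.* (ℚ.- (θ i * part inside g) A)
    -- The leading 1 raises the exponent m_1(u) by one, and θ₁ anticommutes with the variable of the
    -- rule; the two signs cancel.
    ≡⟨ solve 2 (λ s x → (:- s) :* (:- x) := s :* x) refl (sign ∣ u ∣) ((θ i * part inside g) A) ⟩
  sign ∣ u ∣ ℚ.* (θ i * part inside g) A
    ≡⟨ cong (sign ∣ u ∣ ℚ.*_) (*-congʳ (θ i) (Gᵣ-in-in _ (ℕ.<⇒≤ q) u s) A) ⟩
  sign ∣ u ∣ ℚ.* (θ i * Gᵣ (ℕ.<⇒≤ q) u s) A ∎)
  where
  open ≡-Reasoning
  i = fromℕ< q
  g = Gᵣ (ℕ.<⇒≤ p) (u ∷ʳ inside) s

-- A leading 0 changes none of the signs, and the correction that it introduces is a multiple of θ₁.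
Gᵣ-out-out : ∀ (p : suc k ℕ.≤ suc n) (q : k ℕ.≤ n) u s →
             part outside (Gᵣ p (u ∷ʳ outside) s) ≗ Gᵣ q u s
Gᵣ-out-out p q []          zero    A = refl
Gᵣ-out-out p q []          (suc s) A = begin
  F (suc s) A ℚ.- 1ℚ ℚ.* (θ zero * F s) (outside ∷ A)
    ≡⟨ cong (λ x → F (suc s) A ℚ.- 1ℚ ℚ.* x) (θ-zero-out (F s) A) ⟩
  F (suc s) A ℚ.- 1ℚ ℚ.* 0ℚ
    ≡⟨ solve 1 (λ x → x :- con 1ℚ :* con 0ℚ := x) refl (F (suc s) A) ⟩
  F (suc s) A ∎
  where open ≡-Reasoning
Gᵣ-out-out p q (true  ∷ u) s       A = Gᵣ-out-out _ _ u (suc s) A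
Gᵣ-out-out p q (false ∷ u) zero    A = Gᵣ-out-out _ _ u zero A
Gᵣ-out-out p q (false ∷ u) (suc s) A =
  cong₂ ℚ._-_ (Gᵣ-out-out _ _ u (suc s) A) (cong₂ (λ m x → sign m ℚ.* x) (∣∷ʳ∣ u outside)
    (trans (θ-suc-out (fromℕ< q) (Gᵣ (ℕ.<⇒≤ p) (u ∷ʳ outside) s) A)
           (*-congʳ (θ (fromℕ< q)) (Gᵣ-out-out _ (ℕ.<⇒≤ q) u s) A)))

-- The part of F_{1^{s+1}} divisible by θ₁ is θ₁ F_{1^s}, exactly what the rule for the leading 0
-- subtracts. The rules for the other letters preserve the absence of θ₁.
Gᵣ-out-in : ∀ (p : suc k ℕ.≤ suc n) (q : k ℕ.≤ n) u s →
            part inside (Gᵣ p (u ∷ʳ outside) s) ≗ 0ᴿ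
Gᵣ-out-in p q []          zero    A = refl
Gᵣ-out-in p q []          (suc s) A = begin
  F s A ℚ.- 1ℚ ℚ.* (θ zero * F s) (inside ∷ A)
    ≡⟨ cong (λ x → F s A ℚ.- 1ℚ ℚ.* x) (θ-zero-in (F s) A) ⟩
  F s A ℚ.- 1ℚ ℚ.* F s A
    ≡⟨ solve 1 (λ x → x :- con 1ℚ :* x := con 0ℚ) refl (F s A) ⟩
  0ℚ ∎
  where open ≡-Reasoning
Gᵣ-out-in p q (true  ∷ u) s       A = Gᵣ-out-in _ (ℕ.<⇒≤ q) u (suc s) A
Gᵣ-out-in p q (false ∷ u) zero    A = Gᵣ-out-in _ (ℕ.<⇒≤ q) u zero A
Gᵣ-out-in p q (false ∷ u) (suc s) A = begin
  Gᵣ (ℕ.<⇒≤ p) (u ∷ʳ outside) (suc s) (inside ∷ A) ℚ.- c ℚ.* (θ (suc i) * g) (inside ∷ A)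
    ≡⟨ cong₂ (λ x y → x ℚ.- c ℚ.* y) (Gᵣ-out-in _ (ℕ.<⇒≤ q) u (suc s) A) (θ-suc-in i g A) ⟩
  0ℚ ℚ.- c ℚ.* (ℚ.- (θ i * part inside g) A)
    ≡⟨ cong (λ x → 0ℚ ℚ.- c ℚ.* (ℚ.- x)) (*-zeroʳ (θ i) (Gᵣ-out-in _ (ℕ.<⇒≤ q) u s) A) ⟩
  0ℚ ℚ.- c ℚ.* 0ℚ
    ≡⟨ solve 1 (λ x → con 0ℚ :- x :* con 0ℚ := con 0ℚ) refl c ⟩
  0ℚ ∎
  where
  open ≡-Reasoning
  c = sign ∣ u ∷ʳ outside ∣
  i = fromℕ< q
  g = Gᵣ (ℕ.<⇒≤ p) (u ∷ʳ outside) s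

G-∷ : ∀ b (α : Subset n) → G (b ∷ α) ≗ Gᵣ ℕ.≤-refl (reverse α ∷ʳ b) 0
G-∷ b α A = cong (λ u → Gᵣ ℕ.≤-refl u 0 A) (reverse-∷ b α)

G-leadingCoefficient : ∀ (α : Subset n) → G α α ≡ 1ℚ
G-leadingCoefficient []            = refl
G-leadingCoefficient (outside ∷ α) =
  trans (G-∷ outside α _) (trans (Gᵣ-out-out _ ℕ.≤-refl (reverse α) 0 α) (G-leadingCoefficient α))
G-leadingCoefficient (inside  ∷ α) =
  trans (G-∷ inside α _) (trans (Gᵣ-in-in _ ℕ.≤-refl (reverse α) 0 α) (G-leadingCoefficient α))

G-support : ∀ (α A : Subset n) → Occurs (G α) A → A ≤ˡᵉˣ α
G-support [] [] _ = base tt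
G-support (outside ∷ α) (outside ∷ A) occ = next refl (G-support α A λ ≡0 →
  occ (trans (G-∷ outside α _) (trans (Gᵣ-out-out _ ℕ.≤-refl (reverse α) 0 A) ≡0)))
G-support (outside ∷ α) (inside ∷ A) occ =
  contradiction (trans (G-∷ outside α _) (Gᵣ-out-in _ ℕ.≤-refl (reverse α) 0 A)) occ
G-support (inside ∷ α) (outside ∷ A) occ = this Bool.f<t refl
G-support (inside ∷ α) (inside ∷ A) occ = next refl (G-support α A λ ≡0 →
  occ (trans (G-∷ inside α _) (trans (Gᵣ-in-in _ ℕ.≤-refl (reverse α) 0 A) ≡0)))

1≢0 : 1ℚ ≢ 0ℚ
1≢0 ()

leading-G : ∀ {g : R n} α → g ≗ G α → LeadingMonomial g α
leading-G α p =
  (λ ≡0 → 1≢0 (trans (sym (G-leadingCoefficient α)) (trans (sym (p α)) ≡0))) ,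
  λ B occ → G-support α B (occ ∘ trans (p B))

leading-unique : ∀ {f : R n} {A B} → LeadingMonomial f A → LeadingMonomial f B → A ≡ B
leading-unique (occA , maxA) (occB , maxB) =
  Pointwise-≡⇒≡ (≤-antisym sym Bool.<-irrefl Bool.<-asym (maxB _ occA) (maxA _ occB))

-- Membership in the ideal

-- Breaks p q u s says that a string v u 1^s, where v has length p with q
-- ones and u is stored reversed, breaks the ballot condition at or after the
-- end of v.
data Breaks (p q : ℕ) : ∀ {k} → Subset k → ℕ → Set where
  -- A break inside 1^s persists to its end, where it reads p + k + s < 2(q + ∣ u ∣ + s); one s is
  -- cancelled.
  now   : ∀ {u : Subset k} {s} → p ℕ.+ k ℕ.< 2 ℕ.* (q ℕ.+ ∣ u ∣) ℕ.+ s → Breaks p q u s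
  later : ∀ {b} {u : Subset k} {s} → Breaks p q u 0 → Breaks p q (b ∷ u) s

breaks-mono : ∀ {p q} {u : Subset k} {s t} → s ℕ.≤ t → Breaks p q u s → Breaks p q u t
breaks-mono s≤t (now lt)  = now (ℕ.<-≤-trans lt (ℕ.+-monoʳ-≤ _ s≤t))
breaks-mono s≤t (later b) = later b

breaks-start : ∀ {p q} (u : Subset k) {s} → p ℕ.< 2 ℕ.* q → Breaks p q u s
breaks-start {p = p} {q} []      {s} lt = now (subst₂ ℕ._<_ (sym (ℕ.+-identityʳ p))
  (cong (λ m → 2 ℕ.* m ℕ.+ s) (sym (ℕ.+-identityʳ q))) (ℕ.<-≤-trans lt (ℕ.m≤m+n (2 ℕ.* q) s)))
breaks-start (_ ∷ u) lt = later (breaks-start u lt)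

-- The last letter of v is handed over to the string behind it.
breaks-∷ʳ : ∀ {p q} (u : Subset k) {b s} → Breaks (suc p) (q ℕ.+ bit b) u s → Breaks p q (u ∷ʳ b) s
breaks-∷ʳ {k} {p} {q} u {b} {s} (now lt) = now (subst₂ ℕ._<_ (sym (ℕ.+-suc p k))
  (cong (λ m → 2 ℕ.* m ℕ.+ s) (trans (ℕ.+-assoc q (bit b) ∣ u ∣) (cong (q ℕ.+_) (sym (∣∷ʳ∣ u b))))) lt)
breaks-∷ʳ (_ ∷ u) (later br) = later (breaks-∷ʳ u br)

-- Positions count from the left while `Gᵣ` reads from the right; p and q record the length and the
-- 1s of the prefix already passed.
breaks-reverse : ∀ {p q} (α : Subset n) i →
  p ℕ.+ suc (toℕ i) ℕ.< 2 ℕ.* (q ℕ.+ partialSum α i) → Breaks p q (reverse α) 0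
breaks-reverse {p = p} {q} (b ∷ α) i lt =
  subst (λ u → Breaks p q u 0) (sym (reverse-∷ b α)) (breaks-∷ʳ (reverse α) (rest i lt))
  where
  rest : ∀ i → p ℕ.+ suc (toℕ i) ℕ.< 2 ℕ.* (q ℕ.+ partialSum (b ∷ α) i) →
         Breaks (suc p) (q ℕ.+ bit b) (reverse α) 0
  rest zero    lt = breaks-start (reverse α) (subst (ℕ._< 2 ℕ.* (q ℕ.+ bit b)) (ℕ.+-comm p 1) lt)
  rest (suc i) lt = breaks-reverse α i (subst₂ ℕ._<_ (ℕ.+-suc p (suc (toℕ i)))
    (cong (2 ℕ.*_) (sym (ℕ.+-assoc q (bit b) (partialSum α i)))) lt)

breaks-true : ∀ {u : Subset k} {s} → Breaks 0 0 (true ∷ u) s → Breaks 0 0 u (suc s)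
breaks-true {k} {u} {s} (now lt) = now (ℕ.s<s⁻¹ (subst (suc k ℕ.<_)
  (trans (cong (ℕ._+ s) (ℕ.*-suc 2 ∣ u ∣)) (cong suc (sym (ℕ.+-suc (2 ℕ.* ∣ u ∣) s)))) lt))
breaks-true (later b) = breaks-mono z≤n b

-- Dropping a 0 lowers the position and keeps the number of 1s.
breaks-false : ∀ {u : Subset k} {s} → Breaks 0 0 (false ∷ u) s → Breaks 0 0 u s
breaks-false (now lt)  = now (ℕ.<⇒≤ lt)
breaks-false (later b) = breaks-mono z≤n b

-- Dropping a 0 together with a 1 keeps the balance at the end of the block.
breaks-false-pred : ∀ {u : Subset k} {s} → Breaks 0 0 (false ∷ u) (suc s) → Breaks 0 0 u s
breaks-false-pred {k} {u} {s} (now lt) = now (ℕ.s<s⁻¹ (subst (suc k ℕ.<_) (ℕ.+-suc (2 ℕ.* ∣ u ∣) s) lt))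
breaks-false-pred (later b) = breaks-mono z≤n b

Gᵣ∈I : ∀ (k≤n : k ℕ.≤ n) u {s} → Breaks 0 0 u s → I n (Gᵣ k≤n u s)
-- For empty u the break says 0 < s, so the base case is never F_{1^0} = 1.
Gᵣ∈I k≤n []          (now 0<s) = F∈I 0<s
Gᵣ∈I k≤n (true  ∷ u) b = Gᵣ∈I _ u (breaks-true b)
Gᵣ∈I k≤n (false ∷ u) {zero} b = Gᵣ∈I _ u (breaks-false b)
Gᵣ∈I k≤n (false ∷ u) {suc s} b = respects
  (λ A → cong (Gᵣ (ℕ.<⇒≤ k≤n) u (suc s) A ℚ.+_) (sym (ℚ.neg-distribˡ-* (sign ∣ u ∣) (h A))))
  (plus (Gᵣ∈I _ u (breaks-false b))
        (•-ideal (ℚ.- sign ∣ u ∣) (timesˡ (θ (fromℕ< k≤n)) (Gᵣ∈I _ u (breaks-false-pred b)))))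
  where h = θ (fromℕ< k≤n) * Gᵣ (ℕ.<⇒≤ k≤n) u s

G∈I : ∀ (α : Subset n) → BreaksBallot α → I n (G α)
G∈I α (i , br) = Gᵣ∈I ℕ.≤-refl (reverse α) (breaks-reverse α i br)

-- The Gröbner bases

min⇒breaks : ∀ {α : Subset n} → Min 0 α → BreaksBallot α
min⇒breaks m with i , _ , only ← min⇒onlyBreaks m = i , Equivalence.from (only i) refl

∈-subsets : ∀ (A : Subset n) → A ∈ subsets n
∈-subsets []            = Any.here refl
∈-subsets {suc n} (outside ∷ A) = ∈-++⁺ˡ (∈-map⁺ (outside ∷_) (∈-subsets A))
∈-subsets {suc n} (inside  ∷ A) = ∈-++⁺ʳ (List.map (outside ∷_) (subsets n)) (∈-map⁺ (inside ∷_) (∈-subsets A))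

finite-G : ∀ {P : Pred (Subset n) 0ℓ} → Decidable P → IsFinite (λ g → ∃[ α ] (P α × g ≗ G α))
finite-G P? = List.map G (List.filter P? (subsets _)) , λ g → mk⇔
  (λ { (α , Pα , p) → Any.map⁺ (lose (∈-filter⁺ P? (∈-subsets α) Pα) p) })
  (λ any → let α , α∈ , p = find (Any.map⁻ any)
               _ , Pα = ∈-filter⁻ P? {xs = subsets _} α∈
           in α , Pα , p)

-- Treats both sets at once: the upper bound on `P` puts the elements in the ideal, and the lower
-- bound supplies a divisor for every leading monomial.
gröbner : ∀ {P : Pred (Subset n) 0ℓ} → Decidable P →
          (∀ α → P α → BreaksBallot α) → (∀ α → Min 0 α → P α) →
          IsGröbnerBasis (I n) (λ g → ∃[ α ] (P α × g ≗ G α))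
gröbner P? P⇒breaks min⇒P = record
  { finite  = finite-G P?
  ; ⊆-ideal = λ { g (α , Pα , p) → respects (sym ∘ p) (G∈I α (P⇒breaks α Pα)) }
  ; nonzero = λ { g (α , _ , p) g≗0 → let occ , _ = leading-G α p in occ (g≗0 α) }
  ; divides = divides
  }
  where
  divides : ∀ f A → I _ f → LeadingMonomial f A →
            ∃[ g ] ∃[ B ] (_ × LeadingMonomial g B × B ⊆ A)
  divides f A f∈I (occ , max) with ballot-or-min 0 A
  ... | inj₁ b             = contradiction (ballot-coefficient f∈I b max) occ
  ... | inj₂ (B , m , B⊆A) = G B , B , (B , min⇒P B m , λ _ → refl) , leading-G B (λ _ → refl) , B⊆A

breaks? : Decidable (BreaksBallot {n})
breaks? α = Fin.any? λ i → suc (toℕ i) ℕ.<? 2 ℕ.* partialSum α i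

𝒜-gröbner : IsGröbnerBasis (I n) (𝒜 n)
𝒜-gröbner = gröbner breaks? (λ _ → id) (λ _ → min⇒breaks)

ℳ-gröbner : IsGröbnerBasis (I n) (ℳ n)
ℳ-gröbner = gröbner
  (λ α → map′ min⇒onlyBreaks (onlyBreaks⇒min 0 α) (min? 0 α))
  (λ α → min⇒breaks ∘ onlyBreaks⇒min 0 α)
  (λ _ → min⇒onlyBreaks)

ℳ-minimal : IsMinimal (ℳ n)
ℳ-minimal {n} = record
  { monic      = λ { g A (α , _ , p) lead → monic α p (leading-unique lead (leading-G α p)) }
  ; no-divisor = λ { g h A B (α , mα , p) (β , mβ , q) g≉h leadA leadB A⊆B →
      g≉h (agree α β p q (onlyBreaks⇒min 0 α mα) (onlyBreaks⇒min 0 β mβ)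
        (subst₂ _⊆_ (leading-unique leadA (leading-G α p)) (leading-unique leadB (leading-G β q)) A⊆B)) }
  }
  where
  monic : ∀ {g : R n} {A} α → g ≗ G α → A ≡ α → g A ≡ 1ℚ
  monic α p refl = trans (p α) (G-leadingCoefficient α)

  agree : ∀ {g h : R n} α β → g ≗ G α → h ≗ G β → Min 0 α → Min 0 β → α ⊆ β → g ≗ h
  -- Comparable exponents coincide, so `g` and `h` are the same G_α.
  agree α β p q mα mβ α⊆β A with _ , refl ← min-antichain ℕ.≤-refl mα mβ α⊆β =
    trans (p A) (sym (q A))

-- Failure of minimality from two variables on

10⋯0 11⋯0 : Subset (suc (suc n))
10⋯0 = inside ∷ outside ∷ ⊥
11⋯0 = inside ∷ inside ∷ ⊥

10⋯0∈𝒜 : 𝒜 (suc (suc n)) (G 10⋯0)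
10⋯0∈𝒜 = 10⋯0 , (zero , s≤s (s≤s z≤n)) , λ _ → refl

11⋯0∈𝒜 : 𝒜 (suc (suc n)) (G 11⋯0)
11⋯0∈𝒜 = 11⋯0 , (zero , s≤s (s≤s z≤n)) , λ _ → refl

G10⋯0≉G11⋯0 : ¬ (G (10⋯0 {n}) ≗ G 11⋯0)
G10⋯0≉G11⋯0 eq with () ← leading-unique (leading-G 10⋯0 (λ _ → refl)) (leading-G 11⋯0 eq)

-- Both sequences break at the first position, and the leading monomial θ₁ of the first divides θ₁θ₂
-- of the second. In one variable the sequence 1 alone breaks the condition, so there is no such
-- pair.
¬𝒜-minimal : ¬ IsMinimal (𝒜 (suc (suc n)))
¬𝒜-minimal min = IsMinimal.no-divisor min _ _ _ _ 10⋯0∈𝒜 11⋯0∈𝒜 G10⋯0≉G11⋯0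
  (leading-G 10⋯0 λ _ → refl) (leading-G 11⋯0 λ _ → refl) (in⊆in (out⊆ ⊆-refl))

reduced⇒minimal : ∀ {𝒢 : Pred (R n) 0ℓ} → IsReduced 𝒢 → IsMinimal 𝒢
reduced⇒minimal red = record
  { monic      = IsReduced.monic red
  ; no-divisor = λ { g h A B 𝒢g 𝒢h g≉h leadA (occB , _) → IsReduced.no-divisor red g h A B 𝒢g 𝒢h g≉h leadA occB }
  }

corollary4p6 : ∀ (n : ℕ) → 1 ≤ n →
    IsGröbnerBasis (I n) (𝒜 n) ×
    (2 ≤ n → ¬ IsReduced (𝒜 n) × ¬ IsMinimal (𝒜 n)) ×
    (IsGröbnerBasis (I n) (ℳ n) × IsMinimal (ℳ n))
corollary4p6 n _ =
  𝒜-gröbner , (λ { (s≤s (s≤s _)) → ¬𝒜-minimal ∘ reduced⇒minimal , ¬𝒜-minimal }) , ℳ-gröbner , ℳ-minimal
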